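{- For all $k,j,n,m\in\mathbb{N}_0$ and $x,y\in[0,1]$, $$B_{k,j;n,m}(x,y;q)=[x]_q^k[y]_q^j\sum_{l=0}^{n}\sum_{r=0}^{m}\binom{n}{l}\binom{m}{r}B_l^{(k)}\bigl([1-x]_q\bigr)\,B_r^{(j)}\bigl([1-y]_q\bigr)\,S(n-l,k)\,S(m-r,j).$$
   Context: Fix $q\in(0,1)$. For real $x$ put $[x]_q=\frac{1-q^x}{1-q}$. For $k,j,n,m\in\mathbb{Z}$ and $x,y\in[0,1]$, the modified $q$-Bernstein polynomial of two variables is $B_{k,j;n,m}(x,y;q)=\binom{n}{k}\binom{m}{j}[x]_q^k[y]_q^j[1-x]_q^{n-k}[1-y]_q^{m-j}$ if $0\le k\le n$ and $0\le j\le m$, and $B_{k,j;n,m}(x,y;q)=0$ otherwise. For $k\in\mathbb{N}_0$ the generalized Bernoulli polynomials $B_n^{(k)}(z)$ of order $k$ are defined by $\left(\frac{t}{e^t-1}\right)^k e^{zt}=\sum_{n=0}^\infty B_n^{(k)}(z)\frac{t^n}{n!}$. The Stirling numbers of the second kind $S(n,k)$ are defined by $\frac{(e^t-1)^k}{k!}=\sum_{n=0}^\infty S(n,k)\frac{t^n}{n!}$. -}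

module Defs where

open import Algebra.Apartness.Bundles using (HeytingField; HeytingCommutativeRing)
open import Algebra.Bundles using (CommutativeRing)
import Algebra.Properties.Semiring.Exp as Exp
import Algebra.Properties.Semiring.Mult as Mult
import Algebra.Properties.Semiring.Sum as Sum
open import Data.Bool.Base using (_∧_; if_then_else_)
open import Data.Fin.Base using (toℕ)
open import Data.Integer.Base using (ℤ; +_)
open import Data.Nat.Base as ℕ using (ℕ; zero; suc; _∸_; NonZero)
import Data.Nat.Properties as ℕ
open import Data.Nat.Combinatorics using (_C_)
open import Data.Product.Base using (∃-syntax; _×_; proj₁)
open import Data.Sum.Base using (_⊎_)
open import Data.Vec.Base using (Vec; []; _∷_; head; lookup)
import Level
open import Level using (_⊔_)
open import Relation.Binary.Structures using (IsStrictPartialOrder)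
open import Relation.Nullary.Decidable.Core using (does)
open import Relation.Nullary.Negation using (¬_)

record OrderedField c ℓ₁ ℓ₂ ℓ₃ : Set (Level.suc (c ⊔ ℓ₁ ⊔ ℓ₂ ⊔ ℓ₃)) where
  infix 4 _<_ _≤_
  field
    heytingField : HeytingField c ℓ₁ ℓ₂

  open HeytingField heytingField public

  field
    _<_                  : Carrier → Carrier → Set ℓ₃
    isStrictPartialOrder : IsStrictPartialOrder _≈_ _<_
    <⇒#                  : ∀ {x y} → x < y → x # y
    #⇒<⊎>                : ∀ {x y} → x # y → x < y ⊎ y < x
    0<1                  : 0# < 1#
    +-monoˡ-<            : ∀ z {x y} → x < y → x + z < y + z
    *-pos                : ∀ {x y} → 0# < x → 0# < y → 0# < x * y

  private module SPO = IsStrictPartialOrder isStrictPartialOrder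

  _≤_ : Carrier → Carrier → Set ℓ₃
  x ≤ y = ¬ (y < x)

  commutativeRing : CommutativeRing c ℓ₁
  commutativeRing = HeytingCommutativeRing.commutativeRing heytingCommutativeRing

  open CommutativeRing commutativeRing public using (semiring)
  open Exp semiring public using (_^_)
  open Mult semiring public using () renaming (_×_ to _·_)
  open Sum semiring public using (sum; sum-syntax; sum⁺-syntax)

  fromℕ : ℕ → Carrier
  fromℕ n = n · 1#

  -- The witness of `y # 0#` is an inverse of `y - 0#`.
  divide : (x y : Carrier) → 0# < y → Carrier
  divide x y 0<y = x * proj₁ (#⇒invertible (#-sym (<⇒# 0<y)))

  x<y⇒0<y-x : ∀ {x y} → x < y → 0# < y - x
  x<y⇒0<y-x {x} x<y = SPO.<-respˡ-≈ (-‿inverseʳ x) (+-monoˡ-< (- x) x<y)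

  fromℕ-pos : ∀ n .{{_ : NonZero n}} → 0# < fromℕ n
  fromℕ-pos (suc zero)      = SPO.<-respʳ-≈ (sym (+-identityʳ 1#)) 0<1
  fromℕ-pos (suc n@(suc _)) =
    SPO.trans (fromℕ-pos n)
      (SPO.<-respˡ-≈ (+-identityˡ (fromℕ n)) (+-monoˡ-< (fromℕ n) 0<1))

  infixl 7 _/_!
  _/_! : Carrier → ℕ → Carrier
  x / n ! = divide x (fromℕ (n ℕ.!)) (fromℕ-pos (n ℕ.!) {{n ℕ.!≢0}})

  infix 4 _⟶_
  _⟶_ : (ℕ → Carrier) → Carrier → Set (c ⊔ ℓ₃)
  s ⟶ L = ∀ ε → 0# < ε →
    ∃[ N ] (∀ n → N ℕ.≤ n → (L - ε < s n) × (s n < L + ε))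

  -- The two-sided bound follows by exchanging m and n.
  Cauchy : (ℕ → Carrier) → Set (c ⊔ ℓ₃)
  Cauchy s = ∀ ε → 0# < ε →
    ∃[ N ] (∀ m n → N ℕ.≤ m → N ℕ.≤ n → s m < s n + ε)

-- The real numbers, presented axiomatically as the Cauchy-complete
-- Archimedean ordered field, which is unique up to isomorphism.
-- The functions exp and log are determined by their specifications.
record RealNumbers c ℓ₁ ℓ₂ ℓ₃ : Set (Level.suc (c ⊔ ℓ₁ ⊔ ℓ₂ ⊔ ℓ₃)) where
  field
    orderedField : OrderedField c ℓ₁ ℓ₂ ℓ₃

  open OrderedField orderedField public

  field
    archimedean : ∀ x → ∃[ n ] x < fromℕ n
    complete    : ∀ s → Cauchy s → ∃[ L ] s ⟶ L
    exp         : Carrier → Carrier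
    exp-series  : ∀ x → (λ N → ∑[ i < N ] (x ^ toℕ i / toℕ i !)) ⟶ exp x
    log         : ∀ x → 0# < x → Carrier
    exp-log     : ∀ x (0<x : 0# < x) → exp (log x 0<x) ≈ x

-- Formal power series in t; `f n` is the coefficient of tⁿ.
module PowerSeries {c ℓ₁ ℓ₂ ℓ₃} (F : OrderedField c ℓ₁ ℓ₂ ℓ₃) where
  open OrderedField F

  Series : Set c
  Series = ℕ → Carrier

  infixl 7 _*ˢ_
  infixl 6 _-ˢ_
  infixr 8 _^ˢ_

  1ˢ : Series
  1ˢ zero    = 1#
  1ˢ (suc _) = 0#

  _-ˢ_ : Series → Series → Series
  (f -ˢ g) n = f n - g n

  _*ˢ_ : Series → Series → Series
  (f *ˢ g) n = ∑[ i ≤ n ] (f (toℕ i) * g (n ∸ toℕ i))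

  _^ˢ_ : Series → ℕ → Series
  f ^ˢ zero  = 1ˢ
  f ^ˢ suc k = f *ˢ f ^ˢ k

  -- f / t, for f with constant term 0.
  shift : Series → Series
  shift f n = f (suc n)

  -- 1 / f, for f with constant term 1: the coefficients g satisfy
  -- g₀ = 1 and gₙ₊₁ = - (f₁ gₙ + ⋯ + fₙ₊₁ g₀).
  -- `recipCoeffs f n` lists gₙ, …, g₀ in this order.
  recipCoeffs : Series → ∀ n → Vec Carrier (suc n)
  recipCoeffs f zero    = 1# ∷ []
  recipCoeffs f (suc n) =
    - ∑[ i ≤ n ] (f (suc (toℕ i)) * lookup (recipCoeffs f n) i) ∷ recipCoeffs f n

  recip : Series → Series
  recip f n = head (recipCoeffs f n)

  -- e^(z t)
  e^_t : Carrier → Series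
  (e^ z t) n = z ^ n / n !

  e^t-1 : Series
  e^t-1 = e^ 1# t -ˢ 1ˢ

  t/[e^t-1] : Series
  t/[e^t-1] = recip (shift e^t-1)

  -- bernoulli k n z is B_n^{(k)}(z).
  bernoulli : ℕ → ℕ → Carrier → Carrier
  bernoulli k n z = fromℕ (n ℕ.!) * (t/[e^t-1] ^ˢ k *ˢ e^ z t) n

  stirling₂ : ℕ → ℕ → Carrier
  stirling₂ n k = fromℕ (n ℕ.!) * ((e^t-1 ^ˢ k) n / k !)

module QBernstein {c ℓ₁ ℓ₂ ℓ₃} (R : RealNumbers c ℓ₁ ℓ₂ ℓ₃)
  (q : RealNumbers.Carrier R)
  (0<q : RealNumbers._<_ R (RealNumbers.0# R) q)
  (q<1 : RealNumbers._<_ R q (RealNumbers.1# R)) where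
  open RealNumbers R

  q^_ : Carrier → Carrier
  q^ x = exp (x * log q 0<q)

  [_]q : Carrier → Carrier
  [ x ]q = divide (1# - q^ x) (1# - q) (x<y⇒0<y-x q<1)

  -- bernstein k j n m x y is B_{k,j;n,m}(x,y;q).
  bernstein : (k j n m : ℤ) → Carrier → Carrier → Carrier
  bernstein (+ k) (+ j) (+ n) (+ m) x y =
    if does (k ℕ.≤? n) ∧ does (j ℕ.≤? m)
    then fromℕ (n C k) * fromℕ (m C j) * [ x ]q ^ k * [ y ]q ^ j
           * [ 1# - x ]q ^ (n ∸ k) * [ 1# - y ]q ^ (m ∸ j)
    else 0#
  bernstein _ _ _ _ _ _ = 0#

-- The double sum is a product of two single sums. By the Cauchy product,
-- ∑ₗ C(n,l) B_l^{(k)}(z) S(n−l,k) is n! times the coefficient of tⁿ in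
-- (t/(e^t−1))^k e^{zt} (e^t−1)^k / k! = t^k e^{zt} / k!, that is C(n,k) z^{n−k}.
module Submission where

open import Defs
open import Algebra.Bundles using (CommutativeMonoid; CommutativeRing)
import Algebra.Construct.Pointwise as Pointwise
import Algebra.Properties.CommutativeSemigroup as CommutativeSemigroupProperties
import Algebra.Properties.Ring as RingProperties
import Algebra.Properties.Semiring.Mult as MultProperties
import Algebra.Properties.Semiring.Sum as SumProperties
import Algebra.Solver.CommutativeMonoid as CommutativeMonoidSolver
open import Data.Bool.Base using (_∧_; if_then_else_)
open import Data.Fin.Base using (Fin; zero; suc; toℕ)
open import Data.Fin.Properties using (toℕ≤pred[n])
open import Data.Integer.Base using (+_)
open import Data.Nat.Base as ℕ using (ℕ; zero; suc; _∸_; z≤n; s≤s)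
open import Data.Nat.Combinatorics using (_C_; nCk≡n!/k![n-k]!; k![n∸k]!∣n!; k>n⇒nCk≡0)
open import Data.Nat.DivMod using (m/n*n≡m)
import Data.Nat.Properties as ℕ
open import Data.Product.Base using (_,_)
open import Data.Vec.Base using (lookup)
open import Function.Base using (_∘_)
open import Relation.Binary.Bundles using (Setoid)
open import Relation.Binary.PropositionalEquality as ≡ using (_≡_)
import Relation.Binary.Reasoning.Setoid as SetoidReasoning
open import Relation.Nullary.Decidable.Core using (Dec; does; yes; no)
open import Relation.Nullary.Negation using (¬_)

-- Factorials, binomial coefficients and finite sums in an ordered field.

nCk*[k!*[n∸k]!]≡n! : ∀ {n k} → k ℕ.≤ n → (n C k) ℕ.* (k ℕ.! ℕ.* (n ∸ k) ℕ.!) ≡ n ℕ.!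
nCk*[k!*[n∸k]!]≡n! {n} {k} k≤n =
  ≡.trans (≡.cong (ℕ._* (k ℕ.! ℕ.* (n ∸ k) ℕ.!)) (nCk≡n!/k![n-k]! k≤n))
          (m/n*n≡m (k![n∸k]!∣n! k≤n))
  where instance _ = k ℕ.!* (n ∸ k) !≢0

module OrderedFieldProperties {c ℓ₁ ℓ₂ ℓ₃} (F : OrderedField c ℓ₁ ℓ₂ ℓ₃) where
  open OrderedField F
  open CommutativeRing commutativeRing using (ring)
  open RingProperties ring using (-0#≈0#)
  open MultProperties semiring using (×1-homo-*)
  open SumProperties semiring using (sum-cong-≋; *-distribˡ-sum; *-distribʳ-sum)
  open SetoidReasoning setoid

  divide-cancel : ∀ x y (0<y : 0# < y) → divide x y 0<y * y ≈ x
  divide-cancel x y 0<y with #⇒invertible (#-sym (<⇒# 0<y))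
  ... | y⁻¹ , y⁻¹[y-0]≈1 , _ = begin
    x * y⁻¹ * y         ≈⟨ *-assoc x y⁻¹ y ⟩
    x * (y⁻¹ * y)       ≈⟨ *-congˡ (*-congˡ (trans (+-congˡ -0#≈0#) (+-identityʳ y))) ⟨
    x * (y⁻¹ * (y - 0#)) ≈⟨ *-congˡ y⁻¹[y-0]≈1 ⟩
    x * 1#              ≈⟨ *-identityʳ x ⟩
    x                   ∎

  /!-cancel : ∀ x n → x / n ! * fromℕ (n ℕ.!) ≈ x
  /!-cancel x n = divide-cancel x _ _

  -- Holds because `divide` multiplies by an inverse that depends on `n` alone. In this form the
  -- `1/k!` inside every Stirling number becomes a factor that can leave the sum.
  /!-factor : ∀ x n → x / n ! ≈ x * (1# / n !)
  /!-factor x n = *-congˡ (sym (*-identityˡ _))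

  -- The factorials of 0 and 1 both compute to `1`, so `fromℕ 1` is the denominator in the two
  -- lowest coefficients of an exponential series.
  *-fromℕ1 : ∀ x → x * fromℕ 1 ≈ x
  *-fromℕ1 x = trans (*-congˡ (+-identityʳ 1#)) (*-identityʳ x)

  fromℕ-nCk : ∀ {n k} → k ℕ.≤ n →
    fromℕ (n ℕ.!) ≈ fromℕ (n C k) * (fromℕ (k ℕ.!) * fromℕ ((n ∸ k) ℕ.!))
  fromℕ-nCk {n} {k} k≤n = begin
    fromℕ (n ℕ.!)                                       ≡⟨ ≡.cong fromℕ (nCk*[k!*[n∸k]!]≡n! k≤n) ⟨
    fromℕ ((n C k) ℕ.* (k ℕ.! ℕ.* (n ∸ k) ℕ.!))             ≈⟨ ×1-homo-* (n C k) _ ⟩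
    fromℕ (n C k) * fromℕ (k ℕ.! ℕ.* (n ∸ k) ℕ.!)         ≈⟨ *-congˡ (×1-homo-* (k ℕ.!) _) ⟩
    fromℕ (n C k) * (fromℕ (k ℕ.!) * fromℕ ((n ∸ k) ℕ.!)) ∎

  fromℕ-nCk≈0 : ∀ {n k} → n ℕ.< k → fromℕ (n C k) ≈ 0#
  fromℕ-nCk≈0 n<k = reflexive (≡.cong fromℕ (k>n⇒nCk≡0 n<k))

  sum-*-sum : ∀ {m n} (f : Fin m → Carrier) (g : Fin n → Carrier) →
    sum f * sum g ≈ ∑[ i < m ] (∑[ j < n ] (f i * g j))
  sum-*-sum f g = trans (*-distribʳ-sum (sum g) f)
                        (sum-cong-≋ λ i → *-distribˡ-sum (f i) g)

  -- Serves to remove the range test from `bernstein`: out of range one of the two binomial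
  -- coefficients is already zero, so the closed formula is right for all natural indices.
  if-≈ : ∀ {p q} {P : Set p} {Q : Set q} (P? : Dec P) (Q? : Dec Q) {x} →
    (¬ P → x ≈ 0#) → (¬ Q → x ≈ 0#) → (if does P? ∧ does Q? then x else 0#) ≈ x
  if-≈ (yes _) (yes _) _ _ = refl
  if-≈ (yes _) (no ¬q) _ z = sym (z ¬q)
  if-≈ (no ¬p) _       z _ = sym (z ¬p)

-- Formal power series under the Cauchy product.

module PowerSeriesProperties {c ℓ₁ ℓ₂ ℓ₃} (F : OrderedField c ℓ₁ ℓ₂ ℓ₃) where
  open OrderedField F
  open PowerSeries F
  open CommutativeRing commutativeRing using (ring; +-commutativeMonoid; *-commutativeMonoid)
  open OrderedFieldProperties F
  open RingProperties ring using (-0#≈0#)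
  open SumProperties semiring using (sum-cong-≋; sum-cong-≗; *-distribˡ-sum; *-distribʳ-sum)

  seriesSetoid : Setoid c ℓ₁
  seriesSetoid = record { isEquivalence = Pointwise.isEquivalence ℕ isEquivalence }

  open Setoid seriesSetoid using () renaming
    (_≈_ to _≋_; refl to ≋-refl; sym to ≋-sym; trans to ≋-trans)

  -- The inductions below rest on the definitional unfolding
  -- (f *ˢ g) (suc n) = f 0 * g (suc n) + (shift f *ˢ g) n.
  *ˢ-cong : ∀ {f f′ g g′} → f ≋ f′ → g ≋ g′ → f *ˢ g ≋ f′ *ˢ g′
  *ˢ-cong f≋f′ g≋g′ zero    = +-congʳ (*-cong (f≋f′ 0) (g≋g′ 0))
  *ˢ-cong f≋f′ g≋g′ (suc n) =
    +-cong (*-cong (f≋f′ 0) (g≋g′ (suc n))) (*ˢ-cong (f≋f′ ∘ suc) g≋g′ n)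

  *ˢ-zeroˡ : ∀ {f} → (∀ n → f n ≈ 0#) → ∀ g n → (f *ˢ g) n ≈ 0#
  *ˢ-zeroˡ f≋0 g zero    = trans (+-identityʳ _) (trans (*-congʳ (f≋0 0)) (zeroˡ _))
  *ˢ-zeroˡ f≋0 g (suc n) =
    trans (+-cong (trans (*-congʳ (f≋0 0)) (zeroˡ _)) (*ˢ-zeroˡ (f≋0 ∘ suc) g n))
          (+-identityˡ 0#)

  *ˢ-identityˡ : ∀ f → 1ˢ *ˢ f ≋ f
  *ˢ-identityˡ f zero    = trans (+-identityʳ _) (*-identityˡ _)
  *ˢ-identityˡ f (suc n) =
    trans (+-cong (*-identityˡ _) (*ˢ-zeroˡ (λ _ → refl) f n)) (+-identityʳ _)

  -- The definition splits off the first term of the Cauchy product, this lemma the last one.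
  -- Commuting the factors reverses the sum, so the induction for `*ˢ-comm` needs both ends.
  *ˢ-suc : ∀ f g n → (f *ˢ g) (suc n) ≈ (f *ˢ shift g) n + f (suc n) * g 0
  *ˢ-suc f g zero    = +-cong (sym (+-identityʳ _)) (+-identityʳ _)
  *ˢ-suc f g (suc n) = trans (+-congˡ (*ˢ-suc (shift f) g n)) (sym (+-assoc _ _ _))

  *ˢ-comm : ∀ f g → f *ˢ g ≋ g *ˢ f
  *ˢ-comm f g zero    = +-congʳ (*-comm _ _)
  *ˢ-comm f g (suc n) = begin
    f 0 * g (suc n) + (shift f *ˢ g) n ≈⟨ +-cong (*-comm _ _) (*ˢ-comm (shift f) g n) ⟩
    g (suc n) * f 0 + (g *ˢ shift f) n ≈⟨ +-comm _ _ ⟩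
    (g *ˢ shift f) n + g (suc n) * f 0 ≈⟨ *ˢ-suc g f n ⟨
    (g *ˢ f) (suc n)                   ∎
    where open SetoidReasoning setoid

  -- The combination `a * f i + g i` is the shape of `shift (f *ˢ g)`, which unfolds to `f 0` times
  -- `shift g` plus `shift f *ˢ g`. The induction for `*ˢ-assoc` meets it in this form.
  *ˢ-linearˡ : ∀ a f g h n →
    ((λ i → a * f i + g i) *ˢ h) n ≈ a * (f *ˢ h) n + (g *ˢ h) n
  *ˢ-linearˡ a f g h zero    = begin
    (a * f 0 + g 0) * h 0 + 0#           ≈⟨ +-congʳ (trans (distribʳ _ _ _) (+-congʳ (*-assoc _ _ _))) ⟩
    a * (f 0 * h 0) + g 0 * h 0 + 0#     ≈⟨ +-assoc _ _ _ ⟩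
    a * (f 0 * h 0) + (g 0 * h 0 + 0#)   ≈⟨ +-congʳ (*-congˡ (+-identityʳ _)) ⟨
    a * (f *ˢ h) 0 + (g *ˢ h) 0          ∎
    where open SetoidReasoning setoid
  *ˢ-linearˡ a f g h (suc n) = begin
    (a * f 0 + g 0) * h (suc n) + ((λ i → a * f (suc i) + g (suc i)) *ˢ h) n
      ≈⟨ +-cong (trans (distribʳ _ _ _) (+-congʳ (*-assoc _ _ _)))
                (*ˢ-linearˡ a (shift f) (shift g) h n) ⟩
    a * (f 0 * h (suc n)) + g 0 * h (suc n) + (a * (shift f *ˢ h) n + (shift g *ˢ h) n)
      ≈⟨ +-interchange _ _ _ _ ⟩
    a * (f 0 * h (suc n)) + a * (shift f *ˢ h) n + (g *ˢ h) (suc n)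
      ≈⟨ +-congʳ (distribˡ _ _ _) ⟨
    a * (f *ˢ h) (suc n) + (g *ˢ h) (suc n) ∎
    where
    open SetoidReasoning setoid
    open CommutativeSemigroupProperties
      (CommutativeMonoid.commutativeSemigroup +-commutativeMonoid)
      renaming (interchange to +-interchange)

  *ˢ-assoc : ∀ f g h → (f *ˢ g) *ˢ h ≋ f *ˢ (g *ˢ h)
  *ˢ-assoc f g h zero    = +-congʳ (begin
    (f 0 * g 0 + 0#) * h 0 ≈⟨ *-congʳ (+-identityʳ _) ⟩
    f 0 * g 0 * h 0        ≈⟨ *-assoc _ _ _ ⟩
    f 0 * (g 0 * h 0)      ≈⟨ *-congˡ (+-identityʳ _) ⟨
    f 0 * (g 0 * h 0 + 0#) ∎)
    where open SetoidReasoning setoid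
  *ˢ-assoc f g h (suc n) = begin
    (f 0 * g 0 + 0#) * h (suc n) + (shift (f *ˢ g) *ˢ h) n
      ≈⟨ +-cong (trans (*-congʳ (+-identityʳ _)) (*-assoc _ _ _))
                (*ˢ-linearˡ (f 0) (shift g) (shift f *ˢ g) h n) ⟩
    f 0 * (g 0 * h (suc n)) + (f 0 * (shift g *ˢ h) n + ((shift f *ˢ g) *ˢ h) n)
      ≈⟨ +-assoc _ _ _ ⟨
    f 0 * (g 0 * h (suc n)) + f 0 * (shift g *ˢ h) n + ((shift f *ˢ g) *ˢ h) n
      ≈⟨ +-cong (sym (distribˡ _ _ _)) (*ˢ-assoc (shift f) g h n) ⟩
    f 0 * (g *ˢ h) (suc n) + (shift f *ˢ (g *ˢ h)) n ∎
    where open SetoidReasoning setoid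

  *ˢ-commutativeMonoid : CommutativeMonoid c ℓ₁
  *ˢ-commutativeMonoid = record
    { ε = 1ˢ
    ; isCommutativeMonoid = record
      { isMonoid = record
        { isSemigroup = record
          { isMagma = record
            { isEquivalence = Setoid.isEquivalence seriesSetoid
            ; ∙-cong        = *ˢ-cong
            }
          ; assoc = *ˢ-assoc
          }
        ; identity = *ˢ-identityˡ , λ f → ≋-trans (*ˢ-comm f 1ˢ) (*ˢ-identityˡ f)
        }
      ; comm = *ˢ-comm
      }
    }

  open CommutativeMonoid *ˢ-commutativeMonoid using ()
    renaming (∙-congˡ to *ˢ-congˡ; ∙-congʳ to *ˢ-congʳ; identityʳ to *ˢ-identityʳ;
              commutativeSemigroup to *ˢ-commutativeSemigroup)
  open CommutativeSemigroupProperties *ˢ-commutativeSemigroup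
    using (interchange; xy∙z≈xz∙y; x∙yz≈y∙xz)

  -- Powers of series and multiplication by powers of `t`.

  ^ˢ-congˡ : ∀ {f g} k → f ≋ g → f ^ˢ k ≋ g ^ˢ k
  ^ˢ-congˡ zero    f≋g = ≋-refl
  ^ˢ-congˡ (suc k) f≋g = *ˢ-cong f≋g (^ˢ-congˡ k f≋g)

  ^ˢ-distrib-*ˢ : ∀ f g k → (f *ˢ g) ^ˢ k ≋ f ^ˢ k *ˢ g ^ˢ k
  ^ˢ-distrib-*ˢ f g zero    = ≋-sym (*ˢ-identityˡ 1ˢ)
  ^ˢ-distrib-*ˢ f g (suc k) =
    ≋-trans (*ˢ-congˡ {f *ˢ g} (^ˢ-distrib-*ˢ f g k)) (interchange f g (f ^ˢ k) (g ^ˢ k))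

  -- The tail is written with `1ˢ` so that `shift t` is `1ˢ` by definition, and multiplication by
  -- `t` reduces to `*ˢ-identityˡ`.
  t : Series
  t zero    = 0#
  t (suc n) = 1ˢ n

  t*ˢ-zero : ∀ f → (t *ˢ f) 0 ≈ 0#
  t*ˢ-zero f = trans (+-identityʳ _) (zeroˡ _)

  t*ˢ-suc : ∀ f n → (t *ˢ f) (suc n) ≈ f n
  t*ˢ-suc f n = trans (+-cong (zeroˡ _) (*ˢ-identityˡ f n)) (+-identityˡ _)

  -- Justifies reading `shift f` as the quotient of `f` by `t`.
  t*ˢ-shift : ∀ f → f 0 ≈ 0# → t *ˢ shift f ≋ f
  t*ˢ-shift f f₀≈0 zero    = trans (t*ˢ-zero (shift f)) (sym f₀≈0)
  t*ˢ-shift f f₀≈0 (suc n) = t*ˢ-suc (shift f) n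

  -- One factor `t` moves every coefficient up by one place, so stripping it lowers `k` and `n`
  -- together until `k` is zero.
  t^k*ˢ-≥ : ∀ {k n} → k ℕ.≤ n → ∀ f → (t ^ˢ k *ˢ f) n ≈ f (n ∸ k)
  t^k*ˢ-≥ z≤n f = *ˢ-identityˡ f _
  t^k*ˢ-≥ {suc k} {suc n} (s≤s k≤n) f =
    trans (*ˢ-assoc t (t ^ˢ k) f (suc n))
          (trans (t*ˢ-suc (t ^ˢ k *ˢ f) n) (t^k*ˢ-≥ k≤n f))

  -- The same descent now reaches coefficient 0 while a factor `t` is left, and `t` has no constant
  -- term.
  t^k*ˢ-< : ∀ {n k} → n ℕ.< k → ∀ f → (t ^ˢ k *ˢ f) n ≈ 0#
  t^k*ˢ-< {zero}  {suc k} _         f =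
    trans (*ˢ-assoc t (t ^ˢ k) f 0) (t*ˢ-zero (t ^ˢ k *ˢ f))
  t^k*ˢ-< {suc n} {suc k} (s≤s n<k) f =
    trans (*ˢ-assoc t (t ^ˢ k) f (suc n))
          (trans (t*ˢ-suc (t ^ˢ k *ˢ f) n) (t^k*ˢ-< n<k f))

  -- Reciprocals of series with constant term 1.

  lookup-recipCoeffs : ∀ f n (i : Fin (suc n)) →
    lookup (recipCoeffs f n) i ≡ recip f (n ∸ toℕ i)
  lookup-recipCoeffs f zero    zero    = ≡.refl
  lookup-recipCoeffs f (suc n) zero    = ≡.refl
  lookup-recipCoeffs f (suc n) (suc i) = lookup-recipCoeffs f n i

  -- The recursion behind `recip` is the vanishing of coefficient `suc n` of the product, solved for
  -- the newest coefficient. It never divides, hence the constant term 1.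
  *ˢ-recip : ∀ f → f 0 ≈ 1# → f *ˢ recip f ≋ 1ˢ
  *ˢ-recip f f₀≈1 zero    = trans (+-identityʳ _) (trans (*-identityʳ _) f₀≈1)
  *ˢ-recip f f₀≈1 (suc n) = begin
    f 0 * - sum coeffs + (shift f *ˢ recip f) n
      ≈⟨ +-congʳ (trans (*-congʳ f₀≈1) (*-identityˡ _)) ⟩
    - sum coeffs + (shift f *ˢ recip f) n
      -- The vector lists the coefficients in descending order, so entry `i` is coefficient
      -- `n ∸ toℕ i` and the negated sum is itself a Cauchy product.
      ≈⟨ +-congʳ (-‿cong (reflexive (sum-cong-≗ {suc n} {coeffs} λ i →
           ≡.cong (f (suc (toℕ i)) *_) (lookup-recipCoeffs f n i)))) ⟩
    - (shift f *ˢ recip f) n + (shift f *ˢ recip f) n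
      ≈⟨ -‿inverseˡ _ ⟩
    0# ∎
    where
    open SetoidReasoning setoid
    coeffs : Fin (suc n) → Carrier
    coeffs i = f (suc (toℕ i)) * lookup (recipCoeffs f n) i

  -- The series `e^t-1` and `t/[e^t-1]`.

  e^t-1-zero : e^t-1 0 ≈ 0#
  e^t-1-zero = trans (+-congʳ (trans (sym (*-fromℕ1 _)) (/!-cancel 1# 0))) (-‿inverseʳ 1#)

  -- This coefficient is the constant term of `shift e^t-1`, which must be 1 for `recip` to invert
  -- that series.
  e^t-1-one : e^t-1 1 ≈ 1#
  e^t-1-one = begin
    1# ^ 1 / 1 ! - 0# ≈⟨ trans (+-congˡ -0#≈0#) (+-identityʳ _) ⟩
    1# ^ 1 / 1 !      ≈⟨ trans (sym (*-fromℕ1 _)) (/!-cancel (1# ^ 1) 1) ⟩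
    1# * 1#           ≈⟨ *-identityʳ 1# ⟩
    1#                ∎
    where open SetoidReasoning setoid

  -- Split `e^t-1` into `t` and `shift e^t-1`; the second factor cancels, since `t/[e^t-1]` is by
  -- definition its reciprocal.
  t/[e^t-1]*[e^t-1] : t/[e^t-1] *ˢ e^t-1 ≋ t
  t/[e^t-1]*[e^t-1] = begin
    t/[e^t-1] *ˢ e^t-1                ≈⟨ *ˢ-congˡ {t/[e^t-1]} (≋-sym (t*ˢ-shift e^t-1 e^t-1-zero)) ⟩
    t/[e^t-1] *ˢ (t *ˢ shift e^t-1)   ≈⟨ x∙yz≈y∙xz t/[e^t-1] t (shift e^t-1) ⟩
    t *ˢ (t/[e^t-1] *ˢ shift e^t-1)   ≈⟨ *ˢ-congˡ {t} (*ˢ-comm t/[e^t-1] (shift e^t-1)) ⟩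
    t *ˢ (shift e^t-1 *ˢ t/[e^t-1])   ≈⟨ *ˢ-congˡ {t} (*ˢ-recip (shift e^t-1) e^t-1-one) ⟩
    t *ˢ 1ˢ                           ≈⟨ *ˢ-identityʳ t ⟩
    t                                 ∎
    where open SetoidReasoning seriesSetoid

  -- Convolution of Bernoulli polynomials with Stirling numbers.

  bernoulli-stirling-series : ∀ k z →
    (t/[e^t-1] ^ˢ k *ˢ e^ z t) *ˢ e^t-1 ^ˢ k ≋ t ^ˢ k *ˢ e^ z t
  bernoulli-stirling-series k z = begin
    (t/[e^t-1] ^ˢ k *ˢ e^ z t) *ˢ e^t-1 ^ˢ k ≈⟨ xy∙z≈xz∙y (t/[e^t-1] ^ˢ k) (e^ z t) (e^t-1 ^ˢ k) ⟩
    -- The Bernoulli order and the lower Stirling index are the same `k`, so the two powers merge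
    -- into one power of a product.
    (t/[e^t-1] ^ˢ k *ˢ e^t-1 ^ˢ k) *ˢ e^ z t ≈⟨ *ˢ-congʳ (^ˢ-distrib-*ˢ t/[e^t-1] e^t-1 k) ⟨
    (t/[e^t-1] *ˢ e^t-1) ^ˢ k *ˢ e^ z t      ≈⟨ *ˢ-congʳ (^ˢ-congˡ k t/[e^t-1]*[e^t-1]) ⟩
    t ^ˢ k *ˢ e^ z t                         ∎
    where open SetoidReasoning seriesSetoid

  -- For `k ≤ n` the coefficient is that of `e^ z t` at `n ∸ k`, whose denominator combines with
  -- `n!` and `1/k!` into the binomial coefficient.
  n!t^ke^zt/k! : ∀ k n z →
    fromℕ (n ℕ.!) * (t ^ˢ k *ˢ e^ z t) n * (1# / k !) ≈ fromℕ (n C k) * z ^ (n ∸ k)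
  n!t^ke^zt/k! k n z with k ℕ.≤? n
  ... | yes k≤n = begin
    fromℕ (n ℕ.!) * (t ^ˢ k *ˢ e^ z t) n * (1# / k !)
      ≈⟨ *-congʳ (*-cong (fromℕ-nCk k≤n) (t^k*ˢ-≥ k≤n (e^ z t))) ⟩
    fromℕ (n C k) * (fromℕ (k ℕ.!) * fromℕ ((n ∸ k) ℕ.!)) * (z ^ (n ∸ k) / n ∸ k !) * (1# / k !)
      ≈⟨ solve 5 (λ c f g x y → ((c ⊕ (f ⊕ g)) ⊕ x) ⊕ y ⊜ c ⊕ ((x ⊕ g) ⊕ (y ⊕ f))) refl
           (fromℕ (n C k)) (fromℕ (k ℕ.!)) (fromℕ ((n ∸ k) ℕ.!)) (z ^ (n ∸ k) / n ∸ k !) (1# / k !) ⟩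
    fromℕ (n C k) * ((z ^ (n ∸ k) / n ∸ k !) * fromℕ ((n ∸ k) ℕ.!) * (1# / k ! * fromℕ (k ℕ.!)))
      ≈⟨ *-congˡ (*-cong (/!-cancel _ (n ∸ k)) (/!-cancel 1# k)) ⟩
    fromℕ (n C k) * (z ^ (n ∸ k) * 1#)
      ≈⟨ *-congˡ (*-identityʳ _) ⟩
    fromℕ (n C k) * z ^ (n ∸ k) ∎
    where
    open SetoidReasoning setoid
    open CommutativeMonoidSolver *-commutativeMonoid
  -- Here `n ∸ k` truncates to zero and the power of `z` is 1, so it is the binomial coefficient
  -- that makes the right side vanish.
  ... | no k≰n = begin
    fromℕ (n ℕ.!) * (t ^ˢ k *ˢ e^ z t) n * (1# / k !)
      ≈⟨ *-congʳ (trans (*-congˡ (t^k*ˢ-< (ℕ.≰⇒> k≰n) (e^ z t))) (zeroʳ _)) ⟩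
    0# * (1# / k !)             ≈⟨ zeroˡ _ ⟩
    0#                          ≈⟨ zeroˡ _ ⟨
    0# * z ^ (n ∸ k)            ≈⟨ *-congʳ (fromℕ-nCk≈0 (ℕ.≰⇒> k≰n)) ⟨
    fromℕ (n C k) * z ^ (n ∸ k) ∎
    where open SetoidReasoning setoid

  bernoulli-stirling : ∀ k n z →
    ∑[ l ≤ n ] (fromℕ (n C toℕ l) * bernoulli k (toℕ l) z * stirling₂ (n ∸ toℕ l) k)
      ≈ fromℕ (n C k) * z ^ (n ∸ k)
  bernoulli-stirling k n z = begin
    ∑[ l ≤ n ] (fromℕ (n C toℕ l) * bernoulli k (toℕ l) z * stirling₂ (n ∸ toℕ l) k)
      ≈⟨ sum-cong-≋ {suc n} summand ⟩
    ∑[ l ≤ n ] (fromℕ (n ℕ.!) * AB l * (1# / k !))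
      ≈⟨ *-distribʳ-sum {suc n} (1# / k !) (λ l → fromℕ (n ℕ.!) * AB l) ⟨
    (∑[ l ≤ n ] (fromℕ (n ℕ.!) * AB l)) * (1# / k !)
      ≈⟨ *-congʳ (*-distribˡ-sum {suc n} (fromℕ (n ℕ.!)) AB) ⟨
    fromℕ (n ℕ.!) * (A *ˢ B) n * (1# / k !)
      ≈⟨ *-congʳ (*-congˡ (bernoulli-stirling-series k z n)) ⟩
    fromℕ (n ℕ.!) * (t ^ˢ k *ˢ e^ z t) n * (1# / k !)
      ≈⟨ n!t^ke^zt/k! k n z ⟩
    fromℕ (n C k) * z ^ (n ∸ k) ∎
    where
    open SetoidReasoning setoid
    open CommutativeMonoidSolver *-commutativeMonoid
    A B : Series
    A = t/[e^t-1] ^ˢ k *ˢ e^ z t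
    B = e^t-1 ^ˢ k
    AB : Fin (suc n) → Carrier
    AB l = A (toℕ l) * B (n ∸ toℕ l)
    -- The binomial coefficient absorbs the factorials `l!` and `(n ∸ l)!` of the two normalisations
    -- into `n!`, which is independent of `l`. What still depends on `l` is a term of the Cauchy
    -- product.
    summand : ∀ (l : Fin (suc n)) →
      fromℕ (n C toℕ l) * bernoulli k (toℕ l) z * stirling₂ (n ∸ toℕ l) k
        ≈ fromℕ (n ℕ.!) * AB l * (1# / k !)
    summand i = begin
      fromℕ (n C l) * (fromℕ (l ℕ.!) * A l) * (fromℕ ((n ∸ l) ℕ.!) * (B (n ∸ l) / k !))
        ≈⟨ *-congˡ (*-congˡ (/!-factor (B (n ∸ l)) k)) ⟩
      fromℕ (n C l) * (fromℕ (l ℕ.!) * A l) * (fromℕ ((n ∸ l) ℕ.!) * (B (n ∸ l) * (1# / k !)))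
        ≈⟨ solve 6 (λ c f a g b y → (c ⊕ (f ⊕ a)) ⊕ (g ⊕ (b ⊕ y)) ⊜ ((c ⊕ (f ⊕ g)) ⊕ (a ⊕ b)) ⊕ y) refl
             (fromℕ (n C l)) (fromℕ (l ℕ.!)) (A l) (fromℕ ((n ∸ l) ℕ.!)) (B (n ∸ l)) (1# / k !) ⟩
      fromℕ (n C l) * (fromℕ (l ℕ.!) * fromℕ ((n ∸ l) ℕ.!)) * (A l * B (n ∸ l)) * (1# / k !)
        ≈⟨ *-congʳ (*-congʳ (fromℕ-nCk (toℕ≤pred[n] i))) ⟨
      fromℕ (n ℕ.!) * (A l * B (n ∸ l)) * (1# / k !) ∎
      where
      l : ℕ
      l = toℕ i

-- The identity for two variables.

theorem10 : ∀ {c ℓ₁ ℓ₂ ℓ₃} (R : RealNumbers c ℓ₁ ℓ₂ ℓ₃) →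
    let open RealNumbers R
        open PowerSeries orderedField in
    (q : Carrier) (0<q : 0# < q) (q<1 : q < 1#) →
    let open QBernstein R q 0<q q<1 in
    (k j n m : ℕ) (x y : Carrier) →
    0# ≤ x → x ≤ 1# → 0# ≤ y → y ≤ 1# →
    bernstein (+ k) (+ j) (+ n) (+ m) x y ≈
      [ x ]q ^ k * [ y ]q ^ j *
        ∑[ l ≤ n ] (∑[ r ≤ m ] (
          fromℕ (n C toℕ l) * fromℕ (m C toℕ r)
            * bernoulli k (toℕ l) [ 1# - x ]q * bernoulli j (toℕ r) [ 1# - y ]q
            * stirling₂ (n ∸ toℕ l) k * stirling₂ (m ∸ toℕ r) j))
theorem10 R q 0<q q<1 k j n m x y _ _ _ _ = begin
  bernstein (+ k) (+ j) (+ n) (+ m) x y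
    ≈⟨ if-≈ (k ℕ.≤? n) (j ℕ.≤? m)
         (λ k≰n → trans (regroup _ _ _ _ _ _)
           (trans (*-congˡ (*-congʳ (vanish (ℕ.≰⇒> k≰n)))) (trans (*-congˡ (zeroˡ _)) (zeroʳ _))))
         (λ j≰m → trans (regroup _ _ _ _ _ _)
           (trans (*-congˡ (*-congˡ (vanish (ℕ.≰⇒> j≰m)))) (trans (*-congˡ (zeroʳ _)) (zeroʳ _)))) ⟩
  fromℕ (n C k) * fromℕ (m C j) * [ x ]q ^ k * [ y ]q ^ j * u ^ (n ∸ k) * v ^ (m ∸ j)
    ≈⟨ regroup _ _ _ _ _ _ ⟩
  [ x ]q ^ k * [ y ]q ^ j * (fromℕ (n C k) * u ^ (n ∸ k) * (fromℕ (m C j) * v ^ (m ∸ j)))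
    -- Used from right to left: each variable's binomial term expands into its own single sum.
    ≈⟨ *-congˡ (*-cong (bernoulli-stirling k n u) (bernoulli-stirling j m v)) ⟨
  [ x ]q ^ k * [ y ]q ^ j * (sum (term k n u) * sum (term j m v))
    ≈⟨ *-congˡ (sum-*-sum (term k n u) (term j m v)) ⟩
  [ x ]q ^ k * [ y ]q ^ j * ∑[ l ≤ n ] (∑[ r ≤ m ] (term k n u l * term j m v r))
    ≈⟨ *-congˡ (sum-cong-≋ {suc n} λ l → sum-cong-≋ {suc m} (interleave l)) ⟩
  [ x ]q ^ k * [ y ]q ^ j * ∑[ l ≤ n ] (∑[ r ≤ m ] summand l r) ∎
  where
  open RealNumbers R
  open PowerSeries orderedField
  open QBernstein R q 0<q q<1
  open OrderedFieldProperties orderedField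
  open PowerSeriesProperties orderedField
  open CommutativeRing commutativeRing using (*-commutativeMonoid)
  open SumProperties semiring using (sum-cong-≋)
  open CommutativeMonoidSolver *-commutativeMonoid
  open SetoidReasoning setoid

  u v : Carrier
  u = [ 1# - x ]q
  v = [ 1# - y ]q

  term : (k n : ℕ) (z : Carrier) → Fin (suc n) → Carrier
  term k n z l = fromℕ (n C toℕ l) * bernoulli k (toℕ l) z * stirling₂ (n ∸ toℕ l) k

  summand : Fin (suc n) → Fin (suc m) → Carrier
  summand l r =
    fromℕ (n C toℕ l) * fromℕ (m C toℕ r)
      * bernoulli k (toℕ l) u * bernoulli j (toℕ r) v
      * stirling₂ (n ∸ toℕ l) k * stirling₂ (m ∸ toℕ r) j

  interleave : ∀ l r → term k n u l * term j m v r ≈ summand l r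
  interleave l r =
    solve 6 (λ a b c d e f → ((a ⊕ b) ⊕ c) ⊕ ((d ⊕ e) ⊕ f)
                             ⊜ ((((a ⊕ d) ⊕ b) ⊕ e) ⊕ c) ⊕ f) refl
      (fromℕ (n C toℕ l)) (bernoulli k (toℕ l) u) (stirling₂ (n ∸ toℕ l) k)
      (fromℕ (m C toℕ r)) (bernoulli j (toℕ r) v) (stirling₂ (m ∸ toℕ r) j)

  -- Brings each binomial coefficient next to its own power. This is the right side of
  -- `bernoulli-stirling` for each variable, and also the product to which `vanish` applies out of
  -- range.
  regroup : ∀ a b c d e f → a * b * c * d * e * f ≈ c * d * (a * e * (b * f))
  regroup = solve 6 (λ a b c d e f → ((((a ⊕ b) ⊕ c) ⊕ d) ⊕ e) ⊕ f
                                     ⊜ (c ⊕ d) ⊕ ((a ⊕ e) ⊕ (b ⊕ f))) refl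

  vanish : ∀ {n k z} → n ℕ.< k → fromℕ (n C k) * z ≈ 0#
  vanish n<k = trans (*-congʳ (fromℕ-nCk≈0 n<k)) (zeroˡ _)
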